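{- Let $TS=(V,a,Init,Tr)$ be a deterministic transition system with a finite set of labels $\mathcal L$, and let $\varphi=\psi\rightarrow\forall\pi_1:\xi_1,\ldots,\pi_l:\xi_l\cdot\exists\pi_{l+1}:\xi_{l+1},\ldots,\pi_k:\xi_k\cdot\square\phi$. Let $U=S\times\mathcal L^{k-l}$. Consider the following set of constrained Horn clauses over the unknown predicates $\{D_{M,e}(\mathcal V,\mathbf a^\forall)\}_{(M,e)\in U}$: \begin{align*} &\textstyle\bigwedge_{(M,e)\in U}D_{M,e}(\mathcal V,\mathbf a^\forall)\wedge\bigwedge_{i=1}^k Init(V_i)\wedge\psi(\mathcal V)\to\bot\\ &Bad(\mathcal V)\to D_{M,e}(\mathcal V,\mathbf a^\forall)\qquad\text{for every }(M,e)\in U\\ &\neg valid_M(\mathcal V)\to D_{M,e}(\mathcal V,\mathbf a^\forall)\qquad\text{for every }(M,e)\in U\\ &\textstyle\bigwedge_{(M',e')\in U}D_{M',e'}(\mathcal V',\mathbf a'^\forall)\wedge\delta_{M,e}(\mathcal V,\mathcal V',\mathbf a^\forall)\to D_{M,e}(\mathcal V,\mathbf a^\forall)\qquad\text{for every }(M,e)\in U \end{align*} This set of CHCs is satisfiable if and only if $TS\models_G\varphi$ (i.e. $TS$ satisfies $\varphi$ according to the game semantics).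
   Context: Background. Fix a many-sorted first-order theory $\mathcal T$ over signature $\Sigma$ with its intended model; valuations of variables take values in this model, and a set of formulas over $\Sigma$ and unknown (uninterpreted) predicates is satisfiable if the unknown predicates can be interpreted as relations over this model so that all the formulas (with all free variables universally quantified) hold. Transition systems. $TS=(V,a,Init,Tr)$: $V$ is a finite vector of sorted state variables, $a$ a label variable, $Init$ a $\Sigma$-formula over $V$, $Tr$ a $\Sigma$-formula over $V\cup\{a\}\cup V'$ ($V'$ a primed copy of $V$). States are valuations of $V$ (set $\mathcal S$), labels are the values of $a$ (set $\mathcal L$), initial states are those satisfying $Init$, and $R\subseteq\mathcal S\times\mathcal L\times\mathcal S$ is the set of valuations satisfying $Tr$. $TS$ is deterministic if for every $s\in\mathcal S$ and $\ell\in\mathcal L$ there is exactly one $s'$ with $(s,\ell,s')\in R$. Formula $\varphi$. $k\ge1$, $0\le l\le k$; each $\xi_i$ is a $\Sigma$-formula over $V$; $\psi,\phi$ are $\Sigma$-formulas over $\mathcal V=V_1\cup\dots\cup V_k$, where $V_j$ is the copy of $V$ indexed by $j$. A composed state $\bar s=(s_1,\ldots,s_k)\in\mathcal S^k$ is a valuation of $\mathcal V$. Schedules. $S=\mathcal P(\{1,\ldots,k\})\setminus\{\varnothing\}$. $M\in S$ is valid for $\bar s$ if either $s_i\not\models\xi_i$ for all $i\in M$, or $M=\{1,\ldots,k\}$ and $s_i\models\xi_i$ for all $i$. For $\bar\ell\in\mathcal L^k$, write $\bar s\overset{M,\bar\ell}{\rightsquigarrow}\bar s'$ iff $(s_i,\ell_i,s_i')\in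 R$ for all $i\in M$ and $s_i'=s_i$ for all $i\notin M$. Game semantics. The verification game has falsifier states $\mathcal S^k$; verifier states $\mathcal S^k\times\mathcal L^l$; initial states: the $\bar s$ with all $s_i$ initial and $\bar s\models\psi$; bad states: the falsifier states $\bar s$ with $s_i\models\xi_i$ for all $1\le i\le k$ and $\bar s\not\models\phi$. From falsifier state $\bar s$ the falsifier may move to $(\bar s,\bar\ell^\forall)$ for any $\bar\ell^\forall\in\mathcal L^l$. From verifier state $(\bar s,\bar\ell^\forall)$ the verifier may move to any $\bar s'$ such that $\bar s\overset{M,\bar\ell}{\rightsquigarrow}\bar s'$ for some $M$ valid for $\bar s$ and some $\bar\ell=\bar\ell^\forall\bar\ell^\exists$ (concatenation) with $\bar\ell^\exists\in\mathcal L^{k-l}$. A play is a sequence of game states starting from an initial state with consecutive states related by moves; it is winning for the verifier if it is infinite and visits no bad state. A (memoryless) verifier strategy maps each verifier state to a successor allowed by a verifier move; it is winning if all plays in which the verifier follows it are winning for the verifier. $TS\models_G\varphi$ iff the verifier has a winning strategy. Formulas. $\mathbf a^\forall=\langle a_1,\ldots,a_l\rangle$, $\mathbf a^\exists=\langle a_{l+1},\ldots,a_k\rangle$ are copies of the label variable, and $\mathbf a'^\forall$ is a fresh (primed) copy of $\mathbf a^\forall$. $Bad(\mathcal V)=\bigwedge_{i=1}^k\xi_i(V_i)\wedge\neg\phi(\mathcal V)$. $valid_M(\mathcal V)=\bigwedge_{i\in M}\neg\xi_i(V_i)$ if $M\ne\{1,\ldots,k\}$, and $\big(\bigwedge_{i\in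 M}\neg\xi_i(V_i)\big)\vee\big(\bigwedge_{i\in M}\xi_i(V_i)\big)$ if $M=\{1,\ldots,k\}$. For $e\in\mathcal L^{k-l}$, $\delta_{M,e}(\mathcal V,\mathcal V',\mathbf a^\forall)$ is $\bigwedge_{i\in M}Tr(V_i,a_i,V_i')\wedge\bigwedge_{i\notin M}V_i=V_i'$ with the variables $\mathbf a^\exists$ replaced by the concrete labels $e$. -}

module Defs where

open import Level using (0ℓ)
open import Data.Bool using (true; false; if_then_else_)
import Data.Bool.Properties as Bool
open import Data.Empty using (⊥)
open import Data.Fin using (Fin; zero; suc; inject₁; fromℕ; splitAt)
open import Data.Fin.Subset using (Subset; Nonempty) renaming (_∈_ to _∈ₛ_; _∉_ to _∉ₛ_; ⊤ to full)
open import Data.Fin.Subset.Properties using (_∈?_; nonempty?)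
open import Data.Irrelevant using ([_])
open import Data.List using (List; []; _∷_; _++_; concat; concatMap; replicate; map; mapMaybe; foldr; filter; allFin; cartesianProduct)
open import Data.List.Membership.Propositional using (_∈_; mapWith∈)
open import Data.List.Relation.Unary.All as All using (All; []; _∷_)
open import Data.List.Relation.Unary.All.Properties using (++⁺)
open import Data.Maybe as Maybe using (Maybe; just; nothing)
open import Data.Nat using (ℕ; zero; suc; _+_; _≤_)
open import Data.Product using (Σ-syntax; ∃; ∃-syntax; ∃!; _×_; _,_; proj₁; proj₂)
open import Data.Refinement using (Refinement-syntax; _,_; value)
open import Data.Sum using (_⊎_; inj₁; inj₂; [_,_]′)
open import Data.Unit using (⊤)
open import Data.Vec as Vec using (Vec; []; _∷_; lookup)
import Data.Vec.Properties as Vec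
open import Function using (_∘_; id)
open import Function.Bundles using (_↔_; Inverse)
open import Relation.Binary.PropositionalEquality using (_≡_)
open import Relation.Nullary using (¬_; does)
open import Relation.Nullary.Decidable using (¬?; dec⇒maybe)
open import Relation.Unary using (Pred; _⊆_; _∪_; ∅)

record Signature : Set₁ where
  field
    Sort : Set
    Fun  : List Sort → Sort → Set
    Rel  : List Sort → Set

data _▹_ {S : Set} (X : Pred S 0ℓ) (t : S) : Pred S 0ℓ where
  bound : (X ▹ t) t
  free  : X ⊆ (X ▹ t)

module _ (Sig : Signature) where
  open Signature Sig

  -- A vocabulary of variables: X s is the set of variables of sort s.
  -- Renamings X ⊆ Y and valuations X ⊆ Carrier are sort-preserving maps.
  Vocabulary : Set₁
  Vocabulary = Pred Sort 0ℓ

  data Term (X : Vocabulary) (s : Sort) : Set where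
    var : X s → Term X s
    app : ∀ {ss} → Fun ss s → All (Term X) ss → Term X s

  infix  7 _≐_
  infixr 6 _∧′_
  infixr 5 _∨′_
  infixr 4 _⇒′_

  data Formula (X : Vocabulary) : Set where
    ⊥′             : Formula X
    _∧′_ _∨′_ _⇒′_ : Formula X → Formula X → Formula X
    ∀′ ∃′          : ∀ t → Formula (X ▹ t) → Formula X
    _≐_            : ∀ {s} → Term X s → Term X s → Formula X
    rel            : ∀ {ss} → Rel ss → All (Term X) ss → Formula X

  Theory : Set₁
  Theory = Pred (Formula ∅) 0ℓ

module _ {Sig : Signature} where
  open Signature Sig

  infix 8 ¬′_
  ¬′_ : ∀ {X} → Formula Sig X → Formula Sig X
  ¬′ φ = φ ⇒′ ⊥′

  ⋀ : ∀ {X} → List (Formula Sig X) → Formula Sig X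
  ⋀ = foldr _∧′_ (¬′ ⊥′)

  lift▹ : ∀ {X Y : Vocabulary Sig} {t} → X ⊆ Y → (X ▹ t) ⊆ (Y ▹ t)
  lift▹ f bound    = bound
  lift▹ f (free x) = free (f x)

  mutual
    renameTerm : ∀ {X Y : Vocabulary Sig} → X ⊆ Y → Term Sig X ⊆ Term Sig Y
    renameTerm f (var x)    = var (f x)
    renameTerm f (app g ts) = app g (renameTerms f ts)

    renameTerms : ∀ {X Y : Vocabulary Sig} → X ⊆ Y → All (Term Sig X) ⊆ All (Term Sig Y)
    renameTerms f []       = []
    renameTerms f (t ∷ ts) = renameTerm f t ∷ renameTerms f ts

  rename : ∀ {X Y : Vocabulary Sig} → X ⊆ Y → Formula Sig X → Formula Sig Y
  rename f ⊥′         = ⊥′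
  rename f (φ ∧′ ψ)   = rename f φ ∧′ rename f ψ
  rename f (φ ∨′ ψ)   = rename f φ ∨′ rename f ψ
  rename f (φ ⇒′ ψ)   = rename f φ ⇒′ rename f ψ
  rename f (∀′ t φ)   = ∀′ t (rename (lift▹ f) φ)
  rename f (∃′ t φ)   = ∃′ t (rename (lift▹ f) φ)
  rename f (t ≐ u)    = renameTerm f t ≐ renameTerm f u
  rename f (rel r ts) = rel r (renameTerms f ts)

-- As usual in first-order logic, every sort has a nonempty domain.
record Structure (Sig : Signature) : Set₁ where
  open Signature Sig
  field
    Carrier  : Sort → Set
    nonempty : ∀ s → Carrier s
    fun      : ∀ {ss s} → Fun ss s → All Carrier ss → Carrier s
    relation : ∀ {ss} → Rel ss → All Carrier ss → Set

module Semantics {Sig : Signature} (𝔐 : Structure Sig) where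
  open Signature Sig
  open Structure 𝔐

  Valuation : Vocabulary Sig → Set
  Valuation X = X ⊆ Carrier

  extend : ∀ {X t} → Valuation X → Carrier t → Valuation (X ▹ t)
  extend ρ d bound    = d
  extend ρ d (free x) = ρ x

  mutual
    eval : ∀ {X} → Valuation X → Term Sig X ⊆ Carrier
    eval ρ (var x)    = ρ x
    eval ρ (app f ts) = fun f (evals ρ ts)

    evals : ∀ {X} → Valuation X → All (Term Sig X) ⊆ All Carrier
    evals ρ []       = []
    evals ρ (t ∷ ts) = eval ρ t ∷ evals ρ ts

  infix 3 _⊨_
  _⊨_ : ∀ {X} → Valuation X → Formula Sig X → Set
  ρ ⊨ ⊥′       = ⊥
  ρ ⊨ φ ∧′ ψ   = (ρ ⊨ φ) × (ρ ⊨ ψ)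
  ρ ⊨ φ ∨′ ψ   = (ρ ⊨ φ) ⊎ (ρ ⊨ ψ)
  ρ ⊨ φ ⇒′ ψ   = ρ ⊨ φ → ρ ⊨ ψ
  ρ ⊨ ∀′ t φ   = (d : Carrier t) → extend ρ d ⊨ φ
  ρ ⊨ ∃′ t φ   = Σ[ d ∈ Carrier t ] (extend ρ d ⊨ φ)
  ρ ⊨ t ≐ u    = eval ρ t ≡ eval ρ u
  ρ ⊨ rel r ts = relation r (evals ρ ts)

  Models : Theory Sig → Set
  Models 𝒯 = ∀ {φ} → 𝒯 φ → (λ ()) ⊨ φ

module Clauses {Sig : Signature} (𝔐 : Structure Sig)
               (Unknown : Set) (arity : Unknown → List (Signature.Sort Sig)) where
  open Structure 𝔐
  open Semantics 𝔐

  Atom : Vocabulary Sig → Set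
  Atom X = Σ[ p ∈ Unknown ] All (Term Sig X) (arity p)

  -- The clause  atoms ∧ constraint → head, where the head nothing stands
  -- for ⊥.  The constraint may mention elements of the model: an element
  -- d ∈ Carrier s is used as a variable of sort s whose value is always d, and so acts as a constant.
  record CHC : Set₁ where
    field
      vars       : Vocabulary Sig
      atoms      : List (Atom vars)
      constraint : Formula Sig (vars ∪ Carrier)
      head       : Maybe (Atom vars)

  Interpretation : Set₁
  Interpretation = (p : Unknown) → All Carrier (arity p) → Set

  module _ (I : Interpretation) where

    HoldsAtom : ∀ {X} → Valuation X → Atom X → Set
    HoldsAtom ρ (p , ts) = I p (evals ρ ts)

    HoldsHead : ∀ {X} → Valuation X → Maybe (Atom X) → Set
    HoldsHead ρ (just A) = HoldsAtom ρ A
    HoldsHead ρ nothing  = ⊥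

    Holds : CHC → Set
    Holds c = (ρ : Valuation vars) → All (HoldsAtom ρ) atoms →
              [ ρ , id ]′ ⊨ constraint → HoldsHead ρ head
      where open CHC c

  Satisfiable : List CHC → Set₁
  Satisfiable cs = Σ[ I ∈ Interpretation ] All (Holds I) cs

data TrVar {S : Set} (V : List S) (a : S) : Pred S 0ℓ where
  cur : (_∈ V) ⊆ TrVar V a
  lab : TrVar V a a
  nxt : (_∈ V) ⊆ TrVar V a

-- V lists the sorts of the state variables: a variable of sort s is a
-- position at which s occurs in V.
record TransitionSystem (Sig : Signature) : Set where
  open Signature Sig
  field
    V    : List Sort
    a    : Sort
    Init : Formula Sig (_∈ V)
    Tr   : Formula Sig (TrVar V a)

-- The copies V₁ , … , Vₖ of V.
Composed : {S : Set} → ℕ → List S → Pred S 0ℓ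
Composed k V s = Fin k × (s ∈ V)

-- The formula  ψ → ∀π₁:ξ₁,…,πₗ:ξₗ · ∃πₗ₊₁:ξₗ₊₁,…,πₖ:ξₖ · □ϕ, given by
-- the number l of universal and the number m of existential traces.
record Specification {Sig : Signature} (TS : TransitionSystem Sig) : Set where
  open TransitionSystem TS
  field
    l m : ℕ
  k : ℕ
  k = l + m
  field
    1≤k : 1 ≤ k
    ξ   : Fin k → Formula Sig (_∈ V)
    ψ ϕ : Formula Sig (Composed k V)

module Executions {Sig : Signature} (𝔐 : Structure Sig) (TS : TransitionSystem Sig) where
  open Structure 𝔐
  open Semantics 𝔐
  open TransitionSystem TS

  State : Set
  State = All Carrier V

  Label : Set
  Label = Carrier a

  _⊨ˢ_ : State → Formula Sig (_∈ V) → Set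
  s ⊨ˢ φ = All.lookup s ⊨ φ

  trVal : State → Label → State → Valuation (TrVar V a)
  trVal s ℓ s′ (cur x) = All.lookup s x
  trVal s ℓ s′ lab     = ℓ
  trVal s ℓ s′ (nxt x) = All.lookup s′ x

  R : State → Label → State → Set
  R s ℓ s′ = trVal s ℓ s′ ⊨ Tr

  Deterministic : Set
  Deterministic = ∀ s ℓ → ∃! _≡_ (R s ℓ)

  FiniteLabels : Set
  FiniteLabels = ∃[ n ] (Fin n ↔ Label)

data Sequence (A : Set) : Set where
  finite   : ∀ n → (Fin (suc n) → A) → Sequence A
  infinite : (ℕ → A) → Sequence A

module _ {A : Set} where

  first : Sequence A → A
  first (finite n π)  = π zero
  first (infinite π)  = π 0

  Consecutive : (A → A → Set) → Sequence A → Set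
  Consecutive _~_ (finite n π) = ∀ i → π (inject₁ i) ~ π (suc i)
  Consecutive _~_ (infinite π) = ∀ i → π i ~ π (suc i)

  Infinite : Sequence A → Set
  Infinite (finite n π) = ⊥
  Infinite (infinite π) = ⊤

  Visits : (A → Set) → Sequence A → Set
  Visits P (finite n π) = ∃[ i ] P (π i)
  Visits P (infinite π) = ∃[ i ] P (π i)

  -- A sequence is only allowed to end where there is no next step.
  Complete : (A → A → Set) → Sequence A → Set
  Complete _~_ (finite n π) = ¬ (∃[ b ] π (fromℕ n) ~ b)
  Complete _~_ (infinite π) = ⊤

Schedule : ℕ → Set
Schedule k = [ M ∈ Subset k ∣ Nonempty M ]

module Game {Sig : Signature} (𝔐 : Structure Sig)
            (TS : TransitionSystem Sig) (Φ : Specification TS) where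
  open Semantics 𝔐
  open TransitionSystem TS
  open Specification Φ
  open Executions 𝔐 TS

  FState : Set
  FState = Vec State k

  VState : Set
  VState = FState × Vec Label l

  data GameState : Set where
    falsifier : FState → GameState
    verifier  : VState → GameState

  composedVal : FState → Valuation (Composed k V)
  composedVal s̄ (i , x) = All.lookup (lookup s̄ i) x

  _⊨ᶜ_ : FState → Formula Sig (Composed k V) → Set
  s̄ ⊨ᶜ φ = composedVal s̄ ⊨ φ

  Initial : FState → Set
  Initial s̄ = (∀ i → lookup s̄ i ⊨ˢ Init) × s̄ ⊨ᶜ ψ

  BadState : FState → Set
  BadState s̄ = (∀ i → lookup s̄ i ⊨ˢ ξ i) × ¬ (s̄ ⊨ᶜ ϕ)

  Valid : Schedule k → FState → Set
  Valid M s̄ = (∀ i → i ∈ₛ value M → ¬ (lookup s̄ i ⊨ˢ ξ i))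
            ⊎ (value M ≡ full × (∀ i → lookup s̄ i ⊨ˢ ξ i))

  _⟨_,_⟩⇝_ : FState → Schedule k → Vec Label k → FState → Set
  s̄ ⟨ M , ℓ̄ ⟩⇝ s̄′ =
      (∀ i → i ∈ₛ value M → R (lookup s̄ i) (lookup ℓ̄ i) (lookup s̄′ i))
    × (∀ i → i ∉ₛ value M → lookup s̄′ i ≡ lookup s̄ i)

  VMove : VState → FState → Set
  VMove (s̄ , ℓ∀) s̄′ =
    Σ[ M ∈ Schedule k ] Σ[ ℓ∃ ∈ Vec Label m ]
      (Valid M s̄ × s̄ ⟨ M , ℓ∀ Vec.++ ℓ∃ ⟩⇝ s̄′)

  data Move : GameState → GameState → Set where
    falsify : ∀ s̄ ℓ∀ → Move (falsifier s̄) (verifier (s̄ , ℓ∀))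
    verify  : ∀ {v s̄′} → VMove v s̄′ → Move (verifier v) (falsifier s̄′)

  data InitialGS : GameState → Set where
    initial : ∀ {s̄} → Initial s̄ → InitialGS (falsifier s̄)

  data BadGS : GameState → Set where
    bad : ∀ {s̄} → BadState s̄ → BadGS (falsifier s̄)

  -- Plays are maximal: a play ends only in a state without moves.
  IsPlay : Sequence GameState → Set
  IsPlay π = InitialGS (first π) × Consecutive Move π × Complete Move π

  WinningPlay : Sequence GameState → Set
  WinningPlay π = Infinite π × ¬ Visits BadGS π

  Strategy : Set
  Strategy = (v : VState) → ∃ (VMove v)

  data Chosen (σ : Strategy) : GameState → GameState → Set where
    falsifierStep : ∀ {s̄ g} → Chosen σ (falsifier s̄) g
    verifierStep  : ∀ {v} → Chosen σ (verifier v) (falsifier (proj₁ (σ v)))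

  Winning : Strategy → Set
  Winning σ = ∀ π → IsPlay π → Consecutive (Chosen σ) π → WinningPlay π

  VerifierWins : Set
  VerifierWins = ∃ Winning

_⊨G[_]_ : ∀ {Sig} (TS : TransitionSystem Sig) → Structure Sig → Specification TS → Set
TS ⊨G[ 𝔐 ] Φ = Game.VerifierWins 𝔐 TS Φ

vectors : ∀ {A : Set} → List A → ∀ n → List (Vec A n)
vectors xs zero    = [] ∷ []
vectors xs (suc n) = concatMap (λ x → map (x ∷_) (vectors xs n)) xs

schedules : ∀ k → List (Schedule k)
schedules k = mapMaybe (λ M → Maybe.map (λ p → M , [ p ]) (dec⇒maybe (nonempty? M)))
                       (vectors (true ∷ false ∷ []) k)

module Encoding {Sig : Signature} (𝔐 : Structure Sig)
                (TS : TransitionSystem Sig) (Φ : Specification TS) where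
  open Signature Sig
  open Structure 𝔐
  open TransitionSystem TS
  open Specification Φ
  open Executions 𝔐 TS

  U : Set
  U = Schedule k × Vec Label m

  -- The variables 𝒱 and 𝐚∀.
  data GVar : Vocabulary Sig where
    state : Composed k V ⊆ GVar
    lab∀  : Fin l → GVar a

  -- The variables 𝒱 , 𝐚∀ together with 𝒱′ , 𝐚′∀.
  data GVar² : Vocabulary Sig where
    plain primed : GVar ⊆ GVar²

  -- The variables 𝒱 , 𝒱′ and a₁ , … , aₖ.
  data ΔVar : Vocabulary Sig where
    curᵢ nxtᵢ : Composed k V ⊆ ΔVar
    labᵢ      : Fin k → ΔVar a

  arity : U → List Sort
  arity _ = concat (replicate k V) ++ replicate l a

  open Clauses 𝔐 U arity public

  stateArgs : ∀ {P : Vocabulary Sig} n → (Fin n → (_∈ V) ⊆ P) → All P (concat (replicate n V))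
  stateArgs zero    g = []
  stateArgs (suc n) g = ++⁺ (All.tabulate (g zero)) (stateArgs n (λ i → g (suc i)))

  labelArgs : ∀ {P : Vocabulary Sig} n → (Fin n → P a) → All P (replicate n a)
  labelArgs zero    g = []
  labelArgs (suc n) g = g zero ∷ labelArgs n (g ∘ suc)

  arguments : ∀ {P : Vocabulary Sig} → GVar ⊆ P → ∀ u → All P (arity u)
  arguments {P} f _ =
    ++⁺ (stateArgs {P} k (λ i x → f (state (i , x)))) (labelArgs {P} l (f ∘ lab∀))

  D : ∀ {X : Vocabulary Sig} → GVar ⊆ X → U → Atom X
  D f u = u , arguments (λ x → var (f x)) u

  members nonmembers : Subset k → List (Fin k)
  members    M = filter (_∈? M) (allFin k)
  nonmembers M = filter (λ i → ¬? (i ∈? M)) (allFin k)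

  _at_ : Formula Sig (_∈ V) → Fin k → Formula Sig (Composed k V)
  φ at i = rename (i ,_) φ

  Bad : Formula Sig (Composed k V)
  Bad = ⋀ (map (λ i → ξ i at i) (allFin k)) ∧′ ¬′ ϕ

  noneHolds allHold : Subset k → Formula Sig (Composed k V)
  noneHolds M = ⋀ (map (λ i → ¬′ (ξ i at i)) (members M))
  allHold   M = ⋀ (map (λ i → ξ i at i) (members M))

  valid : Schedule k → Formula Sig (Composed k V)
  valid (M , _) = if does (Vec.≡-dec Bool._≟_ M full) then noneHolds M ∨′ allHold M else noneHolds M

  copy : Fin k → TrVar V a ⊆ ΔVar
  copy i (cur x) = curᵢ (i , x)
  copy i lab     = labᵢ i
  copy i (nxt x) = nxtᵢ (i , x)

  δ : Schedule k → Formula Sig ΔVar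
  δ (M , _) = ⋀ (map (λ i → rename (copy i) Tr) (members M))
           ∧′ ⋀ (map (λ i → ⋀ (mapWith∈ V (λ x → var (curᵢ (i , x)) ≐ var (nxtᵢ (i , x)))))
                     (nonmembers M))

  instantiate : Vec Label m → ΔVar ⊆ (GVar² ∪ Carrier)
  instantiate e (curᵢ x) = inj₁ (plain (state x))
  instantiate e (nxtᵢ x) = inj₁ (primed (state x))
  instantiate e (labᵢ i) =
    [ (λ j → inj₁ (plain (lab∀ j))) , (λ j → inj₂ (lookup e j)) ]′ (splitAt l i)

  -- δ with aₗ₊₁ , … , aₖ replaced by the concrete labels e.
  δ[_] : U → Formula Sig (GVar² ∪ Carrier)
  δ[ M , e ] = rename (instantiate e) (δ M)

  over𝒱 : Formula Sig (Composed k V) → Formula Sig (GVar ∪ Carrier)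
  over𝒱 = rename (λ x → inj₁ (state x))

  module _ (fin : FiniteLabels) where

    allU : List U
    allU = cartesianProduct (schedules k) (vectors (map (Inverse.to (proj₂ fin)) (allFin _)) m)

    initClause : CHC
    initClause = record
      { vars       = GVar
      ; atoms      = map (D id) allU
      ; constraint = over𝒱 (⋀ (map (λ i → Init at i) (allFin k)) ∧′ ψ)
      ; head       = nothing
      }

    badClause invalidClause stepClause : U → CHC
    badClause u = record
      { vars       = GVar
      ; atoms      = []
      ; constraint = over𝒱 Bad
      ; head       = just (D id u)
      }
    invalidClause u = record
      { vars       = GVar
      ; atoms      = []
      ; constraint = over𝒱 (¬′ valid (proj₁ u))
      ; head       = just (D id u)
      }
    stepClause u = record
      { vars       = GVar²
      ; atoms      = map (D primed) allU
      ; constraint = δ[ u ]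
      ; head       = just (D plain u)
      }

    clauses : List CHC
    clauses = initClause ∷ map badClause allU ++ map invalidClause allU ++ map stepClause allU

{-# OPTIONS --safe #-}
module Submission where

-- A solution of the clauses says which moves u = (M , e) of the verifier to
-- avoid: D_u (s̄ , ℓ∀) may be read as "u must not be played in (s̄ , ℓ∀)". By the
-- clauses, a u with D_u false is a legal move, s̄ is not bad, and in the successor
-- (unique by determinism) every choice of universal labels again leaves some D_u
-- false, so playing such u wins. Conversely, a winning strategy σ solves the
-- clauses by letting D_u (s̄ , ℓ∀) be false exactly when no play of σ from s̄
-- visits a bad state and u is the move of σ in (s̄ , ℓ∀).

open import Level using (0ℓ)
open import Axiom.ExcludedMiddle using (ExcludedMiddle)
open import Data.Bool using (true; false)
import Data.Bool.Properties as Bool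
open import Data.Empty using (⊥-elim-irr)
open import Data.Fin using (Fin; zero; suc; splitAt; fromℕ; fromℕ<)
open import Data.Fin.Properties using (all?; ¬∀⟶∃¬)
open import Data.Fin.Subset using (Subset; ⁅_⁆) renaming (_∈_ to _∈ₛ_; _∉_ to _∉ₛ_; ⊤ to full)
open import Data.Fin.Subset.Properties using (_∈?_; nonempty?; ∈⊤; x∈⁅x⁆; x∈⁅y⁆⇒x≡y)
open import Data.Irrelevant using ([_])
open import Data.List using (List; []; _∷_; concat; replicate; map; allFin)
open import Data.List.Membership.Propositional using (_∈_; mapWith∈; find; lose)
open import Data.List.Membership.Propositional.Properties
  using (∈-allFin; ∈-cartesianProduct⁺; ∈-concatMap⁺; ∈-filter⁺; ∈-filter⁻; ∈-map⁺)
open import Data.List.Relation.Unary.All as All using (All; []; _∷_)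
open import Data.List.Relation.Unary.All.Properties
  using (++⁺; ++⁻; ++↔; map⁺; map⁻; ++⁻ˡ; ++⁻ʳ; ¬All⇒Any¬)
open import Data.List.Relation.Unary.Any as Any using (here; there)
open import Data.List.Relation.Unary.Any.Properties using (mapMaybe⁺)
open import Data.Maybe as Maybe using (Maybe)
import Data.Maybe.Relation.Unary.Any as MAny
open import Data.Nat using (ℕ; zero; suc)
open import Data.Product using (Σ-syntax; ∃; _×_; _,_; proj₁; proj₂; map₂)
open import Data.Product.Function.NonDependent.Propositional using (_×-⇔_)
open import Data.Refinement using (_,_; value)
open import Data.Sum using (inj₁; inj₂; [_,_]′)
open import Data.Sum.Function.Propositional using (_⊎-⇔_)
open import Data.Unit using (tt)
open import Data.Vec as Vec using (Vec; []; _∷_; lookup)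
import Data.Vec.Properties as Vec
open import Function using (_∘_; id)
open import Function.Bundles using (_⇔_; mk⇔; Equivalence; Inverse)
open import Function.Construct.Composition using (_⇔-∘_)
open import Function.Construct.Identity using (⇔-id)
open import Function.Related.TypeIsomorphisms using (→-cong-⇔; ¬-cong-⇔)
open import Relation.Binary.PropositionalEquality
open import Relation.Nullary using (¬_; yes; no; contradiction)
open import Relation.Nullary.Decidable using (¬?; decidable-stable; dec⇒maybe)
open import Relation.Unary using (_⊆_)
open import Defs

open Equivalence using (to; from)

-- Equivalences, vectors and heterogeneous lists

Π-cong-⇔ : ∀ {A : Set} {P Q : A → Set} → (∀ x → P x ⇔ Q x) → (∀ x → P x) ⇔ (∀ x → Q x)
Π-cong-⇔ e = mk⇔ (λ p x → to (e x) (p x)) (λ q x → from (e x) (q x))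

Σ-cong-⇔ : ∀ {A : Set} {P Q : A → Set} → (∀ x → P x ⇔ Q x) → ∃ P ⇔ ∃ Q
Σ-cong-⇔ e = mk⇔ (map₂ λ {x} → to (e x)) (map₂ λ {x} → from (e x))

≡-cong-⇔ : ∀ {A : Set} {x x′ y y′ : A} → x ≡ x′ → y ≡ y′ → (x ≡ y) ⇔ (x′ ≡ y′)
≡-cong-⇔ refl refl = ⇔-id _

lookup-injective : ∀ {A : Set} {n} (xs ys : Vec A n) → (∀ i → lookup xs i ≡ lookup ys i) → xs ≡ ys
lookup-injective xs ys eq =
  trans (sym (Vec.tabulate∘lookup xs)) (trans (Vec.tabulate-cong eq) (Vec.tabulate∘lookup ys))

vector-choice : ∀ {A : Set} {n} {P : Fin n → A → Set} →
                (∀ i → ∃ (P i)) → Σ[ xs ∈ Vec A n ] (∀ i → P i (lookup xs i))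
vector-choice {P = P} h =
  Vec.tabulate (proj₁ ∘ h) ,
  λ i → subst (P i) (sym (Vec.lookup∘tabulate (proj₁ ∘ h) i)) (proj₂ (h i))

All-lookup-injective : ∀ {S : Set} {P : S → Set} {xs : List S} (ps qs : All P xs) →
                       (∀ {x} (x∈ : x ∈ xs) → All.lookup ps x∈ ≡ All.lookup qs x∈) → ps ≡ qs
All-lookup-injective []       []       eq = refl
All-lookup-injective (p ∷ ps) (q ∷ qs) eq =
  cong₂ _∷_ (eq (here refl)) (All-lookup-injective ps qs (eq ∘ there))

All-tabulate∘lookup : ∀ {S : Set} {P : S → Set} {xs : List S} (ps : All P xs) →
                      All.tabulate (All.lookup ps) ≡ ps
All-tabulate∘lookup []       = refl
All-tabulate∘lookup (p ∷ ps) = cong (p ∷_) (All-tabulate∘lookup ps)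

All-lookup∘tabulate : ∀ {S : Set} {P : S → Set} {xs : List S} (f : ∀ {x} → x ∈ xs → P x) →
                      ∀ {x} (x∈ : x ∈ xs) → All.lookup (All.tabulate f) x∈ ≡ f x∈
All-lookup∘tabulate f (here refl) = refl
All-lookup∘tabulate f (there x∈)  = All-lookup∘tabulate (f ∘ there) x∈

-- Completeness of the enumerations of vectors and schedules

∈-vectors : ∀ {A : Set} {xs : List A} → (∀ x → x ∈ xs) → ∀ {n} (v : Vec A n) → v ∈ vectors xs n
∈-vectors all []      = here refl
∈-vectors {xs = xs} all {suc n} (x ∷ v) =
  ∈-concatMap⁺ (λ x → map (x ∷_) (vectors xs n))
               (lose (all x) (∈-map⁺ (x ∷_) (∈-vectors all v)))

∈-schedules : ∀ {k} (M : Schedule k) → M ∈ schedules k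
∈-schedules {k} (M , [ p ]) =
  mapMaybe⁺ f (vectors (true ∷ false ∷ []) k)
    (Any.map selected (∈-map⁺ f (∈-vectors bools M)))
  where
  f : Subset k → Maybe (Schedule k)
  f M = Maybe.map (λ p → M , [ p ]) (dec⇒maybe (nonempty? M))

  bools : ∀ b → b ∈ true ∷ false ∷ []
  bools true  = here refl
  bools false = there (here refl)

  -- Nonemptiness is an irrelevant component, so the proof found by `nonempty?` yields the same
  -- schedule by `refl`; a negative answer is refuted by the irrelevant `p`.
  selected : ∀ {x} → f M ≡ x → MAny.Any ((M , [ p ]) ≡_) x
  selected eq with nonempty? M
  selected refl | yes _ = MAny.just refl
  selected eq   | no ¬p = ⊥-elim-irr (¬p p)

-- Semantics of renamed formulas and of finite conjunctions

module _ {Sig : Signature} (𝔐 : Structure Sig) where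
  open Structure 𝔐
  open Semantics 𝔐

  eval-renameTerm : ∀ {X Y : Vocabulary Sig} (f : X ⊆ Y) {ρ : Valuation Y} {ρ′ : Valuation X} →
                    (∀ {s} (x : X s) → ρ (f x) ≡ ρ′ x) →
                    ∀ {s} (t : Term Sig X s) → eval ρ (renameTerm f t) ≡ eval ρ′ t
  evals-renameTerms : ∀ {X Y : Vocabulary Sig} (f : X ⊆ Y) {ρ : Valuation Y} {ρ′ : Valuation X} →
                      (∀ {s} (x : X s) → ρ (f x) ≡ ρ′ x) →
                      ∀ {ss} (ts : All (Term Sig X) ss) → evals ρ (renameTerms f ts) ≡ evals ρ′ ts
  eval-renameTerm f e (var x)    = e x
  eval-renameTerm f e (app g ts) = cong (fun g) (evals-renameTerms f e ts)
  evals-renameTerms f e []       = refl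
  evals-renameTerms f e (t ∷ ts) = cong₂ _∷_ (eval-renameTerm f e t) (evals-renameTerms f e ts)

  extend-lift▹ : ∀ {X Y : Vocabulary Sig} {t} (f : X ⊆ Y) {ρ : Valuation Y} {ρ′ : Valuation X} →
                 (∀ {s} (x : X s) → ρ (f x) ≡ ρ′ x) → (d : Carrier t) →
                 ∀ {s} (x : (X ▹ t) s) → extend {Y} ρ d (lift▹ {Sig = Sig} f x) ≡ extend {X} ρ′ d x
  extend-lift▹ f e d bound    = refl
  extend-lift▹ f e d (free x) = e x

  -- Valuations are functions, so agreement is required only pointwise; `extend-lift▹` carries it
  -- under quantifiers. Every translation between formulas and game conditions below rests on this.
  ⊨-rename : ∀ {X Y : Vocabulary Sig} (f : X ⊆ Y) {ρ : Valuation Y} {ρ′ : Valuation X} →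
             (∀ {s} (x : X s) → ρ (f x) ≡ ρ′ x) →
             ∀ φ → (ρ ⊨ rename f φ) ⇔ (ρ′ ⊨ φ)
  ⊨-rename f e ⊥′         = ⇔-id _
  ⊨-rename f e (φ ∧′ ψ)   = ⊨-rename f e φ ×-⇔ ⊨-rename f e ψ
  ⊨-rename f e (φ ∨′ ψ)   = ⊨-rename f e φ ⊎-⇔ ⊨-rename f e ψ
  ⊨-rename f e (φ ⇒′ ψ)   = →-cong-⇔ (⊨-rename f e φ) (⊨-rename f e ψ)
  ⊨-rename f e (∀′ t φ)   = Π-cong-⇔ λ d → ⊨-rename (lift▹ {Sig = Sig} f) (extend-lift▹ f e d) φ
  ⊨-rename f e (∃′ t φ)   = Σ-cong-⇔ λ d → ⊨-rename (lift▹ {Sig = Sig} f) (extend-lift▹ f e d) φ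
  ⊨-rename f e (t ≐ u)    = ≡-cong-⇔ (eval-renameTerm f e t) (eval-renameTerm f e u)
  ⊨-rename f {ρ} {ρ′} e (rel r ts) = mk⇔ (subst (relation r) eq) (subst (relation r) (sym eq))
    where
    eq : evals ρ (renameTerms f ts) ≡ evals ρ′ ts
    eq = evals-renameTerms f e ts

  ⊨-⋀-map : ∀ {X} {ρ : Valuation X} {A : Set} (f : A → Formula Sig X) xs →
            (ρ ⊨ ⋀ (map f xs)) ⇔ (∀ x → x ∈ xs → ρ ⊨ f x)
  ⊨-⋀-map f []       = mk⇔ (λ _ _ ()) (λ _ → id)
  ⊨-⋀-map f (x ∷ xs) = mk⇔
    (λ { (p , ps) _ (here refl) → p
       ; (p , ps) y (there y∈)  → to (⊨-⋀-map f xs) ps y y∈ })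
    (λ h → h x (here refl) , from (⊨-⋀-map f xs) (λ y y∈ → h y (there y∈)))

  ⊨-⋀-mapWith∈ : ∀ {X} {ρ : Valuation X} {A : Set} (xs : List A) (f : ∀ {x} → x ∈ xs → Formula Sig X) →
                 (ρ ⊨ ⋀ (mapWith∈ xs f)) ⇔ (∀ {x} (x∈ : x ∈ xs) → ρ ⊨ f x∈)
  ⊨-⋀-mapWith∈ []       f = mk⇔ (λ _ ()) (λ _ → id)
  ⊨-⋀-mapWith∈ (x ∷ xs) f = mk⇔
    (λ { (p , ps) (here refl) → p
       ; (p , ps) (there x∈)  → to (⊨-⋀-mapWith∈ xs (f ∘ there)) ps x∈ })
    (λ h → h (here refl) , from (⊨-⋀-mapWith∈ xs (f ∘ there)) (h ∘ there))

-- Formulas of the encoding and the game conditions they express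

module _ {Sig : Signature} (𝔐 : Structure Sig) (TS : TransitionSystem Sig) (Φ : Specification TS) where
  open Structure 𝔐
  open Semantics 𝔐
  open TransitionSystem TS
  open Specification Φ
  open Executions 𝔐 TS
  open Game 𝔐 TS Φ
  open Encoding 𝔐 TS Φ

  ⊨-at : ∀ s̄ i φ → (s̄ ⊨ᶜ (φ at i)) ⇔ (lookup s̄ i ⊨ˢ φ)
  ⊨-at s̄ i = ⊨-rename 𝔐 (i ,_) (λ _ → refl)

  ⊨-⋀-allFin : ∀ s̄ (φ : Fin k → Formula Sig (_∈ V)) →
               (s̄ ⊨ᶜ ⋀ (map (λ i → φ i at i) (allFin k))) ⇔ (∀ i → lookup s̄ i ⊨ˢ φ i)
  ⊨-⋀-allFin s̄ φ =
    Π-cong-⇔ (λ i → ⊨-at s̄ i (φ i))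
      ⇔-∘ (mk⇔ (λ h i → h i (∈-allFin i)) (λ h i _ → h i)
      ⇔-∘ ⊨-⋀-map 𝔐 (λ i → φ i at i) (allFin k))

  ∈-members : ∀ M {i} → (i ∈ members M) ⇔ (i ∈ₛ M)
  ∈-members M {i} = mk⇔ (proj₂ ∘ ∈-filter⁻ (_∈? M) {xs = allFin k}) (∈-filter⁺ (_∈? M) (∈-allFin i))

  ∈-nonmembers : ∀ M {i} → (i ∈ nonmembers M) ⇔ (i ∉ₛ M)
  ∈-nonmembers M {i} =
    mk⇔ (proj₂ ∘ ∈-filter⁻ (λ i → ¬? (i ∈? M)) {xs = allFin k})
        (∈-filter⁺ (λ i → ¬? (i ∈? M)) (∈-allFin i))

  ⊨-⋀-members : ∀ {X} {ρ : Valuation X} M (f : Fin k → Formula Sig X) →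
                (ρ ⊨ ⋀ (map f (members M))) ⇔ (∀ i → i ∈ₛ M → ρ ⊨ f i)
  ⊨-⋀-members M f =
    Π-cong-⇔ (λ i → →-cong-⇔ (∈-members M) (⇔-id _)) ⇔-∘ ⊨-⋀-map 𝔐 f (members M)

  ⊨-⋀-nonmembers : ∀ {X} {ρ : Valuation X} M (f : Fin k → Formula Sig X) →
                   (ρ ⊨ ⋀ (map f (nonmembers M))) ⇔ (∀ i → i ∉ₛ M → ρ ⊨ f i)
  ⊨-⋀-nonmembers M f =
    Π-cong-⇔ (λ i → →-cong-⇔ (∈-nonmembers M) (⇔-id _)) ⇔-∘ ⊨-⋀-map 𝔐 f (nonmembers M)

  ⊨-Bad : ∀ s̄ → (s̄ ⊨ᶜ Bad) ⇔ BadState s̄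
  ⊨-Bad s̄ = ⊨-⋀-allFin s̄ ξ ×-⇔ ⇔-id _

  InitialFormula : Formula Sig (Composed k V)
  InitialFormula = ⋀ (map (λ i → Init at i) (allFin k)) ∧′ ψ

  ⊨-InitialFormula : ∀ s̄ → (s̄ ⊨ᶜ InitialFormula) ⇔ Initial s̄
  ⊨-InitialFormula s̄ = ⊨-⋀-allFin s̄ (λ _ → Init) ×-⇔ ⇔-id _

  ⊨-noneHolds : ∀ s̄ M → (s̄ ⊨ᶜ noneHolds M) ⇔ (∀ i → i ∈ₛ M → ¬ (lookup s̄ i ⊨ˢ ξ i))
  ⊨-noneHolds s̄ M =
    Π-cong-⇔ (λ i → →-cong-⇔ (⇔-id _) (¬-cong-⇔ (⊨-at s̄ i (ξ i))))
      ⇔-∘ ⊨-⋀-members M (λ i → ¬′ (ξ i at i))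

  ⊨-allHold : ∀ s̄ M → (s̄ ⊨ᶜ allHold M) ⇔ (∀ i → i ∈ₛ M → lookup s̄ i ⊨ˢ ξ i)
  ⊨-allHold s̄ M =
    Π-cong-⇔ (λ i → →-cong-⇔ (⇔-id _) (⊨-at s̄ i (ξ i)))
      ⇔-∘ ⊨-⋀-members M (λ i → ξ i at i)

  -- The formula branches on a decision of `M ≡ full`, whereas `Valid` holds this equation inside a
  -- disjunct. Once the equation is decided, either membership in `M` is automatic or the second
  -- disjunct is impossible.
  ⊨-valid : ∀ s̄ M → (s̄ ⊨ᶜ valid M) ⇔ Valid M s̄
  ⊨-valid s̄ (M , _) with Vec.≡-dec Bool._≟_ M full
  ... | yes refl =
    ⊨-noneHolds s̄ M ⊎-⇔
      (mk⇔ (λ h → refl , λ i → h i ∈⊤) (λ (_ , h) i _ → h i) ⇔-∘ ⊨-allHold s̄ M)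
  ... | no M≢full =
    mk⇔ inj₁ (λ { (inj₁ h) → h ; (inj₂ (M≡full , _)) → contradiction M≡full M≢full })
      ⇔-∘ ⊨-noneHolds s̄ M

  transitionVal : FState → Vec Label k → FState → Valuation ΔVar
  transitionVal s̄ ℓ̄ s̄′ (curᵢ (i , x)) = All.lookup (lookup s̄ i) x
  transitionVal s̄ ℓ̄ s̄′ (nxtᵢ (i , x)) = All.lookup (lookup s̄′ i) x
  transitionVal s̄ ℓ̄ s̄′ (labᵢ i)       = lookup ℓ̄ i

  ⊨-δ : ∀ s̄ M ℓ̄ s̄′ → (transitionVal s̄ ℓ̄ s̄′ ⊨ δ M) ⇔ (s̄ ⟨ M , ℓ̄ ⟩⇝ s̄′)
  ⊨-δ s̄ (M , _) ℓ̄ s̄′ =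
    (Π-cong-⇔ (λ i → →-cong-⇔ (⇔-id _) (⊨-rename 𝔐 (copy i) (agree i) Tr))
       ⇔-∘ ⊨-⋀-members M (λ i → rename (copy i) Tr))
    ×-⇔
    (Π-cong-⇔ (λ i → →-cong-⇔ (⇔-id _) (unchanged i))
       ⇔-∘ ⊨-⋀-nonmembers M (λ i → ⋀ (mapWith∈ V (same i))))
    where
    same : ∀ i {s} → s ∈ V → Formula Sig ΔVar
    same i x = var (curᵢ (i , x)) ≐ var (nxtᵢ (i , x))

    agree : ∀ i {s} (x : TrVar V a s) →
            transitionVal s̄ ℓ̄ s̄′ (copy i x) ≡ trVal (lookup s̄ i) (lookup ℓ̄ i) (lookup s̄′ i) x
    agree i (cur x) = refl
    agree i lab     = refl
    agree i (nxt x) = refl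

    -- The formula equates the variables one at a time; states are lists of values, so equality at
    -- every position is equality of states.
    unchanged : ∀ i → (transitionVal s̄ ℓ̄ s̄′ ⊨ ⋀ (mapWith∈ V (same i))) ⇔ (lookup s̄′ i ≡ lookup s̄ i)
    unchanged i =
      mk⇔ (λ h → All-lookup-injective _ _ (sym ∘ to (⊨-⋀-mapWith∈ 𝔐 V (same i)) h))
          (λ e → from (⊨-⋀-mapWith∈ 𝔐 V (same i)) (λ x → cong (λ s → All.lookup s x) (sym e)))

  -- Verifier states as valuations of the clause variables

  gameVal : VState → Valuation GVar
  gameVal (s̄ , ℓ∀) (state (i , x)) = All.lookup (lookup s̄ i) x
  gameVal (s̄ , ℓ∀) (lab∀ j)        = lookup ℓ∀ j

  gameVal² : VState → VState → Valuation GVar²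
  gameVal² v v′ (plain x)  = gameVal v x
  gameVal² v v′ (primed x) = gameVal v′ x

  fromVal : Valuation GVar → VState
  fromVal ρ = Vec.tabulate (λ i → All.tabulate (λ x → ρ (state (i , x)))) , Vec.tabulate (ρ ∘ lab∀)

  -- This lets a clause quantified over valuations be read as quantified over verifier states. The
  -- lemmas that follow therefore accept any `ρ` agreeing pointwise with some `gameVal v`.
  gameVal-fromVal : ∀ (ρ : Valuation GVar) {s} (x : GVar s) → ρ x ≡ gameVal (fromVal ρ) x
  gameVal-fromVal ρ (state (i , x)) = sym (trans
    (cong (λ s → All.lookup s x) (Vec.lookup∘tabulate _ i))
    (All-lookup∘tabulate (λ x → ρ (state (i , x))) x))
  gameVal-fromVal ρ (lab∀ j) = sym (Vec.lookup∘tabulate _ j)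

  ⊨-over𝒱 : ∀ {ρ : Valuation GVar} v → (∀ {s} (x : GVar s) → ρ x ≡ gameVal v x) → ∀ φ →
            ([ ρ , id ]′ ⊨ over𝒱 φ) ⇔ (proj₁ v ⊨ᶜ φ)
  ⊨-over𝒱 v e = ⊨-rename 𝔐 (λ x → inj₁ (state x)) (λ x → e (state x))

  ⊨-δ[] : ∀ {ρ : Valuation GVar²} v v′ →
          (∀ {s} (x : GVar s) → ρ (plain x) ≡ gameVal v x) →
          (∀ {s} (x : GVar s) → ρ (primed x) ≡ gameVal v′ x) →
          ∀ u → ([ ρ , id ]′ ⊨ δ[ u ]) ⇔ (proj₁ v ⟨ proj₁ u , proj₂ v Vec.++ proj₂ u ⟩⇝ proj₁ v′)
  ⊨-δ[] {ρ} (s̄ , ℓ∀) (s̄′ , _) e e′ (M , ℓ∃) =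
    ⊨-δ s̄ M (ℓ∀ Vec.++ ℓ∃) s̄′ ⇔-∘ ⊨-rename 𝔐 (instantiate ℓ∃) agree (δ M)
    where
    agree : ∀ {s} (x : ΔVar s) →
            [ ρ , id ]′ (instantiate ℓ∃ x) ≡ transitionVal s̄ (ℓ∀ Vec.++ ℓ∃) s̄′ x
    agree (curᵢ x) = e (state x)
    agree (nxtᵢ x) = e′ (state x)
    -- Looking up in a concatenation splits the index in the same way as `instantiate` does. An
    -- existential label is then an element of the model used as a variable, which `id` evaluates to
    -- itself.
    agree (labᵢ i) rewrite Vec.lookup-splitAt l ℓ∀ ℓ∃ i with splitAt l i
    ... | inj₁ j = e (lab∀ j)
    ... | inj₂ j = refl

  -- Argument lists of the unknown predicates

  evals-++⁺ : ∀ {X} (ρ : Valuation X) {ss ts} (ps : All (Term Sig X) ss) (qs : All (Term Sig X) ts) →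
              evals ρ (++⁺ ps qs) ≡ ++⁺ (evals ρ ps) (evals ρ qs)
  evals-++⁺ ρ []       qs = refl
  evals-++⁺ ρ (p ∷ ps) qs = cong (_ ∷_) (evals-++⁺ ρ ps qs)

  evals-tabulate : ∀ {X} (ρ : Valuation X) {ss} (f : ∀ {s} → s ∈ ss → Term Sig X s) →
                   evals ρ (All.tabulate f) ≡ All.tabulate (λ x → eval ρ (f x))
  evals-tabulate ρ {[]}    f = refl
  evals-tabulate ρ {_ ∷ _} f = cong (eval ρ (f (here refl)) ∷_) (evals-tabulate ρ (f ∘ there))

  evals-stateArgs : ∀ {X} (ρ : Valuation X) n (s̄ : Vec State n) (f : Fin n → ∀ {s} → s ∈ V → X s) →
                    (∀ i {s} (x : s ∈ V) → ρ (f i x) ≡ All.lookup (lookup s̄ i) x) →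
                    evals ρ (stateArgs n (λ i x → var (f i x))) ≡ stateArgs n (λ i → All.lookup (lookup s̄ i))
  evals-stateArgs ρ zero    []      f e = refl
  evals-stateArgs ρ (suc n) (s ∷ s̄) f e =
    trans (evals-++⁺ ρ (All.tabulate (λ x → var (f zero x))) _)
          (cong₂ ++⁺
            (trans (evals-tabulate ρ (λ x → var (f zero x)))
                   (All-lookup-injective _ _ (λ x →
                     trans (All-lookup∘tabulate (λ x → ρ (f zero x)) x)
                           (trans (e zero x) (sym (All-lookup∘tabulate (All.lookup s) x))))))
            (evals-stateArgs ρ n s̄ (f ∘ suc) (e ∘ suc)))

  evals-labelArgs : ∀ {X} (ρ : Valuation X) n (ℓ : Vec Label n) (f : Fin n → X a) →
                    (∀ i → ρ (f i) ≡ lookup ℓ i) →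
                    evals ρ (labelArgs n (var ∘ f)) ≡ labelArgs n (lookup ℓ)
  evals-labelArgs ρ zero    []      f e = refl
  evals-labelArgs ρ (suc n) (x ∷ ℓ) f e = cong₂ _∷_ (e zero) (evals-labelArgs ρ n ℓ (f ∘ suc) (e ∘ suc))

  -- Argument lists are data, so here pointwise agreement turns into an equation, along which the
  -- truth of an atom can be transported.
  evals-arguments : ∀ {X} (ρ : Valuation X) (f : GVar ⊆ X) v →
                    (∀ {s} (x : GVar s) → ρ (f x) ≡ gameVal v x) →
                    ∀ u → evals ρ (proj₂ (D f u)) ≡ arguments (gameVal v) u
  evals-arguments ρ f (s̄ , ℓ∀) e u =
    trans (evals-++⁺ ρ (stateArgs k (λ i x → var (f (state (i , x))))) _)
          (cong₂ ++⁺ (evals-stateArgs ρ k s̄ (λ i x → f (state (i , x))) (λ i x → e (state (i , x))))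
                     (evals-labelArgs ρ l ℓ∀ (f ∘ lab∀) (e ∘ lab∀)))

  ++⁻-++⁺ : ∀ {ss ts} (ps : All Carrier ss) (qs : All Carrier ts) → ++⁻ ss (++⁺ ps qs) ≡ (ps , qs)
  ++⁻-++⁺ ps qs = Inverse.strictlyInverseʳ ++↔ (ps , qs)

  decodeStates : ∀ n → All Carrier (concat (replicate n V)) → Vec State n
  decodeStates zero    _  = []
  decodeStates (suc n) ds = let s , ds′ = ++⁻ V ds in s ∷ decodeStates n ds′

  decodeLabels : ∀ n → All Carrier (replicate n a) → Vec Label n
  decodeLabels zero    []       = []
  decodeLabels (suc n) (d ∷ ds) = d ∷ decodeLabels n ds

  -- Recovers a verifier state from its argument list, so that a relation on verifier states can
  -- serve as an interpretation of the predicates.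
  decode : ∀ u → All Carrier (arity u) → VState
  decode _ ds =
    let ds₁ , ds₂ = ++⁻ (concat (replicate k V)) ds in decodeStates k ds₁ , decodeLabels l ds₂

  decodeStates-stateArgs : ∀ n (s̄ : Vec State n) →
                           decodeStates n (stateArgs n (λ i → All.lookup (lookup s̄ i))) ≡ s̄
  decodeStates-stateArgs zero    []      = refl
  decodeStates-stateArgs (suc n) (s ∷ s̄)
    rewrite ++⁻-++⁺ (All.tabulate (All.lookup s)) (stateArgs n (λ i → All.lookup (lookup s̄ i))) =
    cong₂ _∷_ (All-tabulate∘lookup s) (decodeStates-stateArgs n s̄)

  decodeLabels-labelArgs : ∀ n (ℓ : Vec Label n) → decodeLabels n (labelArgs n (lookup ℓ)) ≡ ℓ
  decodeLabels-labelArgs zero    []      = refl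
  decodeLabels-labelArgs (suc n) (x ∷ ℓ) = cong (x ∷_) (decodeLabels-labelArgs n ℓ)

  decode-arguments : ∀ u v → decode u (arguments (gameVal v) u) ≡ v
  decode-arguments u (s̄ , ℓ∀)
    rewrite ++⁻-++⁺ (stateArgs k (λ i → All.lookup (lookup s̄ i))) (labelArgs l (lookup ℓ∀)) =
    cong₂ _,_ (decodeStates-stateArgs k s̄) (decodeLabels-labelArgs l ℓ∀)

  -- Clauses as conditions on a relation between moves and verifier states

  module _ (fin : FiniteLabels) where

    -- Finiteness of the labels enters here: it makes the conjunction over `U` a finite list that
    -- omits no move.
    ∈-allU : ∀ u → u ∈ allU fin
    ∈-allU (M , ℓ∃) = ∈-cartesianProduct⁺ (∈-schedules M) (∈-vectors ∈-labels ℓ∃)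
      where
      open Inverse (proj₂ fin) renaming (to to label; from to index; strictlyInverseˡ to label-index)

      ∈-labels : ∀ ℓ → ℓ ∈ map label (allFin _)
      ∈-labels ℓ = subst (_∈ map label (allFin _)) (label-index ℓ) (∈-map⁺ label (∈-allFin (index ℓ)))

    -- The clauses read in the game: E u (s̄ , ℓ∀) is the truth of D_u (s̄ , ℓ∀).
    record Solution (E : U → VState → Set) : Set where
      field
        init    : ∀ v → All (λ u → E u v) (allU fin) → ¬ Initial (proj₁ v)
        bad⇒    : ∀ u v → BadState (proj₁ v) → E u v
        invalid : ∀ u v → ¬ Valid (proj₁ u) (proj₁ v) → E u v
        step    : ∀ u v v′ → All (λ u′ → E u′ v′) (allU fin) →
                  proj₁ v ⟨ proj₁ u , proj₂ v Vec.++ proj₂ u ⟩⇝ proj₁ v′ → E u v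

    -- The embedding `f` is arbitrary so that one hypothesis covers atoms over the variables
    -- themselves (`id`) and over both copies (`plain`, `primed`).
    Represents : Interpretation → (U → VState → Set) → Set₁
    Represents I E =
      ∀ {X : Vocabulary Sig} {ρ : Valuation X} (f : GVar ⊆ X) v →
      (∀ {s} (x : GVar s) → ρ (f x) ≡ gameVal v x) →
      ∀ u → HoldsAtom I {X} ρ (D f u) ⇔ E u v

    All-D : ∀ I {E} → Represents I E → ∀ {X : Vocabulary Sig} (ρ : Valuation X) (f : GVar ⊆ X) v →
            (∀ {s} (x : GVar s) → ρ (f x) ≡ gameVal v x) →
            All (HoldsAtom I {X} ρ) (map (D f) (allU fin)) ⇔ All (λ u → E u v) (allU fin)
    All-D I r ρ f v e =
      mk⇔ (All.map (λ {u} → to (r {ρ = ρ} f v e u)) ∘ map⁻) (map⁺ ∘ All.map (λ {u} → from (r {ρ = ρ} f v e u)))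

    forU : ∀ {P : CHC → Set} {c : U → CHC} → All P (map c (allU fin)) → ∀ u → P (c u)
    forU ps u = All.lookup (map⁻ ps) (∈-allU u)

    -- Each clause is instantiated at the valuation of the given verifier states, where all required
    -- agreements hold by `refl`.
    interpretation⇒solution : ∀ {I E} → Represents I E → All (Holds I) (clauses fin) → Solution E
    interpretation⇒solution {I} {E} r (pi ∷ ps) = record
      { init    = λ v all i → pi (gameVal v) (from (All-D I r (gameVal v) id v (λ _ → refl)) all)
                                 (from (⊨-over𝒱 v (λ _ → refl) InitialFormula) (from (⊨-InitialFormula (proj₁ v)) i))
      ; bad⇒    = λ u v b → to (r id v (λ _ → refl) u)
                    (forU bads u (gameVal v) [] (from (⊨-over𝒱 v (λ _ → refl) Bad) (from (⊨-Bad (proj₁ v)) b)))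
      ; invalid = λ u v ¬valid → to (r id v (λ _ → refl) u)
                    (forU invalids u (gameVal v) []
                      (from (⊨-over𝒱 v (λ _ → refl) (¬′ valid (proj₁ u)))
                            (¬valid ∘ to (⊨-valid (proj₁ v) (proj₁ u)))))
      ; step    = λ u v v′ all tr → to (r plain v (λ _ → refl) u)
                    (forU steps u (gameVal² v v′) (from (All-D I r (gameVal² v v′) primed v′ (λ _ → refl)) all)
                      (from (⊨-δ[] v v′ (λ _ → refl) (λ _ → refl) u) tr))
      }
      where
      bads     = ++⁻ˡ (map (badClause fin) (allU fin)) ps
      rest     = ++⁻ʳ (map (badClause fin) (allU fin)) ps
      invalids = ++⁻ˡ (map (invalidClause fin) (allU fin)) rest
      steps    = ++⁻ʳ (map (invalidClause fin) (allU fin)) rest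

    -- Here the valuation is arbitrary and is first replaced by the verifier state that `fromVal`
    -- reads off from it, or by two such states for a step clause.
    solution⇒interpretation : ∀ {I E} → Represents I E → Solution E → All (Holds I) (clauses fin)
    solution⇒interpretation {I} {E} r sol =
      (λ ρ atoms c → init (fromVal ρ) (to (All-D I r ρ id (fromVal ρ) (gameVal-fromVal ρ)) atoms)
                       (to (⊨-InitialFormula (proj₁ (fromVal ρ)))
                           (to (⊨-over𝒱 (fromVal ρ) (gameVal-fromVal ρ) InitialFormula) c)))
      ∷ ++⁺ (map⁺ (All.universal bads (allU fin)))
            (++⁺ (map⁺ (All.universal invalids (allU fin))) (map⁺ (All.universal steps (allU fin))))
      where
      open Solution sol

      bads : ∀ u → Holds I (badClause fin u)
      bads u ρ _ c =
        from (r id (fromVal ρ) (gameVal-fromVal ρ) u)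
             (bad⇒ u (fromVal ρ) (to (⊨-Bad (proj₁ (fromVal ρ))) (to (⊨-over𝒱 (fromVal ρ) (gameVal-fromVal ρ) Bad) c)))

      invalids : ∀ u → Holds I (invalidClause fin u)
      invalids u ρ _ c =
        from (r id (fromVal ρ) (gameVal-fromVal ρ) u)
             (invalid u (fromVal ρ)
               (to (⊨-over𝒱 (fromVal ρ) (gameVal-fromVal ρ) (¬′ valid (proj₁ u))) c
                 ∘ from (⊨-valid (proj₁ (fromVal ρ)) (proj₁ u))))

      steps : ∀ u → Holds I (stepClause fin u)
      steps u ρ atoms c =
        from (r plain v (gameVal-fromVal (λ x → ρ (plain x))) u)
             (step u v v′ (to (All-D I r ρ primed v′ (gameVal-fromVal (λ x → ρ (primed x)))) atoms)
               (to (⊨-δ[] v v′ (gameVal-fromVal (λ x → ρ (plain x))) (gameVal-fromVal (λ x → ρ (primed x))) u) c))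
        where
        v v′ : VState
        v  = fromVal (λ x → ρ (plain x))
        v′ = fromVal (λ x → ρ (primed x))

    -- An interpretation becomes a relation on verifier states through `arguments`, and a relation
    -- becomes an interpretation through `decode`.
    satisfiable⇔solution : Satisfiable (clauses fin) ⇔ ∃ Solution
    satisfiable⇔solution = mk⇔
      (λ (I , h) →
        let E = λ u v → I u (arguments (gameVal v) u) in
        E , interpretation⇒solution {I} {E}
              (λ {_} {ρ} f v e u → mk⇔ (subst (I u) (evals-arguments ρ f v e u))
                                       (subst (I u) (sym (evals-arguments ρ f v e u)))) h)
      (λ (E , sol) →
        let I = λ u ds → E u (decode u ds) in
        I , solution⇒interpretation {I} {E}
              (λ {_} {ρ} f v e u → mk⇔ (subst (E u) (decode-evals ρ f v e u))
                                       (subst (E u) (sym (decode-evals ρ f v e u)))) sol)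
      where
      decode-evals : ∀ {X} (ρ : Valuation X) (f : GVar ⊆ X) v →
                     (∀ {s} (x : GVar s) → ρ (f x) ≡ gameVal v x) →
                     ∀ u → decode u (evals ρ (proj₂ (D f u))) ≡ v
      decode-evals ρ f v e u = trans (cong (decode u) (evals-arguments ρ f v e u)) (decode-arguments u v)

    -- From a solution to a winning strategy

    module _ (lem : ExcludedMiddle 0ℓ) (det : Deterministic) {E : U → VState → Set} (sol : Solution E) where
      open Solution sol

      -- The invariant of the strategy: whatever universal labels the falsifier picks, the solution
      -- does not exclude every move.
      W : FState → Set
      W s̄ = ∀ ℓ∀ → ¬ All (λ u → E u (s̄ , ℓ∀)) (allU fin)

      -- The existence half of determinism, applied componentwise: members of `M` move, the others
      -- stay.
      successor : ∀ s̄ M ℓ̄ → ∃ (s̄ ⟨ M , ℓ̄ ⟩⇝_)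
      successor s̄ M ℓ̄ =
        let s̄′ , h = vector-choice {P = Component} component in s̄′ , (λ i → proj₁ (h i)) , (λ i → proj₂ (h i))
        where
        Component : Fin k → State → Set
        Component i s′ = (i ∈ₛ value M → R (lookup s̄ i) (lookup ℓ̄ i) s′)
                       × (i ∉ₛ value M → s′ ≡ lookup s̄ i)

        component : ∀ i → ∃ (Component i)
        component i with i ∈? value M
        ... | yes i∈M = let s′ , r , _ = det (lookup s̄ i) (lookup ℓ̄ i) in
                        s′ , (λ _ → r) , λ i∉M → contradiction i∈M i∉M
        ... | no  i∉M = lookup s̄ i , (λ i∈M → contradiction i∈M i∉M) , λ _ → refl

      -- Witnesses that `full` is nonempty and hence a schedule.
      someIndex : Fin k
      someIndex = fromℕ< 1≤k

      -- If every `ξ i` holds, the full schedule is valid; otherwise some `ξ i` fails and the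
      -- singleton of that `i` is valid.
      valid-schedule : ∀ s̄ → Σ[ M ∈ Schedule k ] Valid M s̄
      valid-schedule s̄ with all? (λ i → lem {lookup s̄ i ⊨ˢ ξ i})
      ... | yes h = (full , [ someIndex , ∈⊤ ]) , inj₂ (refl , h)
      ... | no ¬h = let i , ¬ξ = ¬∀⟶∃¬ k _ (λ i → lem) ¬h in
        (⁅ i ⁆ , [ i , x∈⁅x⁆ i ]) ,
        inj₁ λ j j∈ → subst (λ j → ¬ (lookup s̄ j ⊨ˢ ξ j)) (sym (x∈⁅y⁆⇒x≡y i j∈)) ¬ξ

      -- The default answer where the solution excludes every move, since a strategy must be total.
      -- It also shows that the verifier is never stuck.
      someMove : ∀ v → ∃ (VMove v)
      someMove (s̄ , ℓ∀) =
        let M , M-valid = valid-schedule s̄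
            ℓ∃          = Vec.replicate m (nonempty a)
            s̄′ , tr     = successor s̄ M (ℓ∀ Vec.++ ℓ∃)
        in s̄′ , M , ℓ∃ , M-valid , tr

      -- The move is chosen together with the reason that it preserves `W`, so a single case
      -- distinction settles both.
      W-move : ∀ v → Σ[ move ∈ ∃ (VMove v) ] (W (proj₁ v) → W (proj₁ move))
      W-move v with lem {All (λ u → E u v) (allU fin)}
      -- The labels in `v` themselves refute `W (proj₁ v)`, so preservation is vacuous.
      ... | yes all = someMove v , λ w → contradiction all (w _)
      ... | no ¬all =
        -- Excluded middle yields a move that is not excluded. The contrapositive of `invalid` makes
        -- it legal, and that of `step` puts its successor in `W`.
        let (M , ℓ∃) , _ , ¬E = find (¬All⇒Any¬ (λ _ → lem) (allU fin) ¬all)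
            M-valid           = decidable-stable lem (¬E ∘ invalid (M , ℓ∃) v)
            s̄′ , tr           = successor (proj₁ v) M (proj₂ v Vec.++ ℓ∃)
        in (s̄′ , M , ℓ∃ , M-valid , tr) ,
           λ _ ℓ∀′ all′ → ¬E (step (M , ℓ∃) v (s̄′ , ℓ∀′) all′ tr)

      W-strategy : Strategy
      W-strategy = proj₁ ∘ W-move

      InW : GameState → Set
      InW (falsifier s̄)      = W s̄
      InW (verifier (s̄ , _)) = W s̄

      -- A falsifier move preserves the invariant because `W` already ranges over all universal
      -- labels; a verifier move does so by `W-move`.
      InW-step : ∀ {g g′} → Move g g′ → Chosen W-strategy g g′ → InW g → InW g′
      InW-step (falsify _ _) falsifierStep        w = w
      InW-step (verify _)    (verifierStep {v})   w = proj₂ (W-move v) w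

      -- At a bad state `bad⇒` excludes every move, contradicting `W` at any labels; nonemptiness of
      -- the sort `a` supplies some.
      InW⇒¬bad : ∀ {g} → InW g → ¬ BadGS g
      InW⇒¬bad w (bad {s̄} b) =
        let ℓ∀ = Vec.replicate l (nonempty a) in
        w ℓ∀ (All.universal (λ u → bad⇒ u (s̄ , ℓ∀) b) (allU fin))

      -- Rules out finite plays, which by maximality would end in a state without moves.
      move-exists : ∀ g → ∃ (Move g)
      move-exists (falsifier s̄) = _ , falsify s̄ (Vec.replicate l (nonempty a))
      move-exists (verifier v)  = let s̄′ , move = someMove v in falsifier s̄′ , verify move

      W-strategy-winning : Winning W-strategy
      W-strategy-winning (finite n π)  (_ , _ , complete)     _      = contradiction (move-exists (π (fromℕ n))) complete
      W-strategy-winning (infinite π) (initial₀ , moves , _) chosen = tt , λ (i , b) → InW⇒¬bad (inW i) b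
        where
        InW-initial : ∀ {g} → InitialGS g → InW g
        InW-initial (initial s̄-initial) ℓ∀ all = init _ all s̄-initial

        inW : ∀ i → InW (π i)
        inW zero    = InW-initial initial₀
        inW (suc i) = InW-step (moves i) (chosen i) (inW i)

      solution⇒verifierWins : VerifierWins
      solution⇒verifierWins = W-strategy , W-strategy-winning

    -- From a winning strategy to a solution

    module _ (det : Deterministic) (σ : Strategy) (σ-winning : Winning σ) where

      -- The falsifier's choices are fixed in advance as a stream of labels and `σ` determines the
      -- rest. A round takes two positions, hence the recursion in steps of two.
      play : FState → (ℕ → Vec Label l) → ℕ → GameState
      play s̄ λ∀ 0             = falsifier s̄
      play s̄ λ∀ 1             = verifier (s̄ , λ∀ 0)
      play s̄ λ∀ (suc (suc i)) = play (proj₁ (σ (s̄ , λ∀ 0))) (λ∀ ∘ suc) i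

      play-moves : ∀ s̄ λ∀ i → Move (play s̄ λ∀ i) (play s̄ λ∀ (suc i))
      play-moves s̄ λ∀ 0             = falsify s̄ (λ∀ 0)
      play-moves s̄ λ∀ 1             = verify (proj₂ (σ (s̄ , λ∀ 0)))
      play-moves s̄ λ∀ (suc (suc i)) = play-moves _ (λ∀ ∘ suc) i

      play-chosen : ∀ s̄ λ∀ i → Chosen σ (play s̄ λ∀ i) (play s̄ λ∀ (suc i))
      play-chosen s̄ λ∀ 0             = falsifierStep
      play-chosen s̄ λ∀ 1             = verifierStep
      play-chosen s̄ λ∀ (suc (suc i)) = play-chosen _ (λ∀ ∘ suc) i

      -- The label stream is all the freedom that `σ` leaves, so this speaks of every infinite play
      -- of `σ` from `s̄`, whether or not `s̄` is initial.
      Safe : FState → Set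
      Safe s̄ = ∀ λ∀ i → ¬ BadGS (play s̄ λ∀ i)

      initial⇒safe : ∀ {s̄} → Initial s̄ → Safe s̄
      initial⇒safe {s̄} s̄-initial λ∀ i b =
        proj₂ (σ-winning (infinite (play s̄ λ∀)) (initial s̄-initial , play-moves s̄ λ∀ , tt) (play-chosen s̄ λ∀))
              (i , b)

      safe⇒¬bad : ∀ {s̄} → Safe s̄ → ¬ BadState s̄
      safe⇒¬bad safe b = safe (λ _ → Vec.replicate l (nonempty a)) 0 (bad b)

      prepend : Vec Label l → (ℕ → Vec Label l) → ℕ → Vec Label l
      prepend ℓ∀ λ∀ zero    = ℓ∀
      prepend ℓ∀ λ∀ (suc i) = λ∀ i

      -- A play from the successor is a play from `s̄` with its first round, two positions long,
      -- removed.
      safe-step : ∀ {s̄} ℓ∀ → Safe s̄ → Safe (proj₁ (σ (s̄ , ℓ∀)))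
      safe-step ℓ∀ safe λ∀ i = safe (prepend ℓ∀ λ∀) (suc (suc i))

      choice : VState → U
      choice v = let _ , M , ℓ∃ , _ = σ v in M , ℓ∃

      -- The uniqueness half of determinism. The step clause speaks of any successor under the
      -- chosen schedule and labels, while safety is known for the one that `σ` returns.
      successor-unique : ∀ s̄ M ℓ̄ {s̄₁ s̄₂} → s̄ ⟨ M , ℓ̄ ⟩⇝ s̄₁ → s̄ ⟨ M , ℓ̄ ⟩⇝ s̄₂ → s̄₁ ≡ s̄₂
      successor-unique s̄ M ℓ̄ {s̄₁} {s̄₂} (moved₁ , kept₁) (moved₂ , kept₂) = lookup-injective _ _ component
        where
        component : ∀ i → lookup s̄₁ i ≡ lookup s̄₂ i
        component i with i ∈? value M
        ... | yes i∈M = let _ , _ , unique = det (lookup s̄ i) (lookup ℓ̄ i) in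
                        trans (sym (unique (moved₁ i i∈M))) (unique (moved₂ i i∈M))
        ... | no  i∉M = trans (kept₁ i i∉M) (sym (kept₂ i i∉M))

      -- Stated as a negation, so a clause with this head is proved by refuting its premises for a
      -- safe state and the move of `σ`.
      Avoided : U → VState → Set
      Avoided u v = ¬ (Safe (proj₁ v) × u ≡ choice v)

      -- The move `choice v` occurs in the list, and at a safe state it is not avoided.
      ¬all-avoided : ∀ {v} → Safe (proj₁ v) → ¬ All (λ u → Avoided u v) (allU fin)
      ¬all-avoided {v} safe all = All.lookup all (∈-allU (choice v)) (safe , refl)

      avoided-solution : Solution Avoided
      avoided-solution = record
        { init    = λ v all s̄-initial → ¬all-avoided {v} (initial⇒safe s̄-initial) all
        ; bad⇒    = λ u v b (safe , _) → safe⇒¬bad safe b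
        ; invalid = λ { _ v ¬valid (_ , refl) → let _ , _ , _ , M-valid , _ = σ v in ¬valid M-valid }
        ; step    = λ { u v v′ all tr (safe , refl) →
            -- As `u` is the move of `σ`, both `tr` and `σ-tr` use the same schedule and labels; so
            -- `v′` has the successor chosen by `σ` as its composed state, which is safe.
            let _ , M , ℓ∃ , _ , σ-tr = σ v
                unique = successor-unique (proj₁ v) M (proj₂ v Vec.++ ℓ∃) σ-tr tr
            in ¬all-avoided {v′} (subst Safe unique (safe-step (proj₂ v) safe)) all }
        }

corollary6p7 : ExcludedMiddle 0ℓ →
    (Sig : Signature) (𝒯 : Theory Sig) (𝔐 : Structure Sig) → Semantics.Models 𝔐 𝒯 →
    (TS : TransitionSystem Sig) → Executions.Deterministic 𝔐 TS →
    (fin : Executions.FiniteLabels 𝔐 TS) (Φ : Specification TS) →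
    Encoding.Satisfiable 𝔐 TS Φ (Encoding.clauses 𝔐 TS Φ fin) ⇔ (TS ⊨G[ 𝔐 ] Φ)
corollary6p7 lem Sig 𝒯 𝔐 𝔐⊨𝒯 TS det fin Φ =
  mk⇔ (λ (_ , sol) → solution⇒verifierWins 𝔐 TS Φ fin lem det sol)
      (λ (σ , σ-winning) → _ , avoided-solution 𝔐 TS Φ fin det σ σ-winning)
    ⇔-∘ satisfiable⇔solution 𝔐 TS Φ fin
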